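{- Let $\mathcal K$ be an abstract Krivine structure and let $\mathcal A_{\mathcal K\bullet}=(\mathcal P_\bullet(\Pi),\circ_\bullet,\to_\bullet,\supseteq,\mathsf k_\bullet,\mathsf s_\bullet,\Phi)$ as defined below. On $\mathcal P_\bullet(\Pi)$ consider the relation $\sqsubseteq_\bullet$: $Q\sqsubseteq_\bullet R$ iff there is $t\in\mathrm{QP}$ with $t\perp Q\to_\bullet R$; and the relation $\sqsubseteq_{\mathcal A}$: $Q\sqsubseteq_{\mathcal A}R$ iff there is $F\in\Phi$ with $F\circ_\bullet Q\supseteq R$. Then these two relations coincide, so $\mathcal H_{\mathcal K\bullet}=(\mathcal P_\bullet(\Pi),\sqsubseteq_\bullet)$ and the preorder $\mathcal H_{\mathcal A_{\mathcal K\bullet}}=(\mathcal P_\bullet(\Pi),\sqsubseteq_{\mathcal A})$ are isomorphic; in particular $\mathcal H_{\mathcal K\bullet}$ is a Heyting preorder.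
   Context: An abstract Krivine structure $\mathcal K$ consists of sets $\Lambda,\Pi$, a relation $\perp\subseteq\Lambda\times\Pi$ ($t\perp P$ means $t\perp\pi$ for all $\pi\in P$), a map $\mathrm{push}$ written $t\cdot\pi$ (associating to the right), an application $ts$ on $\Lambda$ (associating to the left), a subset $\mathrm{QP}\subseteq\Lambda$ closed under application, and $\mathsf K,\mathsf S\in\mathrm{QP}$ with: $t\perp s\cdot\pi\Rightarrow ts\perp\pi$; $t\perp\pi\Rightarrow\mathsf K\perp t\cdot s\cdot\pi$; $tu(su)\perp\pi\Rightarrow\mathsf S\perp t\cdot s\cdot u\cdot\pi$. Polars: $L^\perp=\{\pi:\forall t\in L,\ t\perp\pi\}$, ${}^\perp P=\{t:\forall\pi\in P,\ t\perp\pi\}$; $\overline P=({}^\perp P)^\perp$; $\widehat P=\bigcup_{\pi\in P}\overline{\{\pi\}}$; $\mathcal P_\bullet(\Pi)=\{P:\widehat P=P\}$. For $P,Q\subseteq\Pi$: $P\to_\bullet Q=\widehat{\{t\cdot\pi:t\in{}^\perp P,\pi\in Q\}}$, $P\circ_\bullet Q=\{\pi: t\cdot\pi'\in P\ \forall t\in{}^\perp Q,\ \pi'\in\overline{\{\pi\}}\}$. $\mathsf E=\mathsf S(\mathsf K(\mathsf S\mathsf K\mathsf K))$, $\mathsf B=\mathsf S(\mathsf K\mathsf S)\mathsf K$, $\mathsf k_\bullet=\{\mathsf E\mathsf K\}^\perp$, $\mathsf s_\bullet=\{\mathsf E((\mathsf B\mathsf E)\mathsf S)\}^\perp$, $\Phi=\{P\in\mathcal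 P_\bullet(\Pi):\exists t\in\mathrm{QP},\ t\perp P\}$. $\mathcal A_{\mathcal K\bullet}$ is a full adjunction implicative ordered combinatory algebra with order $P\le Q\iff P\supseteq Q$, and its associated Heyting preorder has underlying preorder $\sqsubseteq_{\mathcal A}$, meet $a\wedge b=\mathsf p\circ_\bullet a\circ_\bullet b$ (with $\mathsf p$ the pairing combinator $\lambda^*x\lambda^*y\lambda^*z.zxy$ built from $\mathsf k_\bullet,\mathsf s_\bullet$) and implication $\to_\bullet$. A Heyting preorder is a preorder with finite meets ($\wedge$, top $\top$) and a binary operation $\to$ with $a\wedge b\le c\iff a\le b\to c$. -}

module Defs where

open import Level using (Level; _⊔_) renaming (suc to lsuc)
open import Algebra.Core using (Op₂)
open import Data.Fin.Base using (Fin; zero; suc)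
open import Data.Maybe.Base using (Maybe; just; nothing; maybe′; zipWith)
open import Data.Nat.Base using (ℕ; zero; suc)
open import Data.Product.Base using (∃; ∃₂; ∃-syntax; _×_; _,_; proj₁; proj₂)
open import Relation.Binary.Core using (Rel)
open import Relation.Binary.Definitions using (Maximum)
open import Relation.Binary.Lattice.Definitions using (Infimum; Exponential)
open import Relation.Binary.PropositionalEquality.Core using (_≡_; refl)
open import Relation.Binary.Structures using (IsPreorder)
open import Relation.Unary using (Pred; _∈_; _⊆_; _⊇_; _≐_; ｛_｝)

------------------------------------------------------------------------
-- Heyting preorders

record IsHeytingPreorder {a ℓ₁ ℓ₂} {A : Set a}
  (_≈_ : Rel A ℓ₁) (_≤_ : Rel A ℓ₂)
  (_∧_ : Op₂ A) (⊤ : A) (_⇨_ : Op₂ A) : Set (a ⊔ ℓ₁ ⊔ ℓ₂) where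
  field
    isPreorder  : IsPreorder _≈_ _≤_
    infimum     : Infimum _≤_ _∧_
    maximum     : Maximum _≤_ ⊤
    exponential : Exponential _≤_ _∧_ _⇨_

------------------------------------------------------------------------
-- The signature (A, ∘, →, ≤, k, s, Φ) of an implicative ordered
-- combinatory algebra with filter. The laws are not part of the record:
-- the induced relation ⊑, the pairing combinator and the meet depend on
-- the operations only.

record RawIOCA c e o f : Set (lsuc (c ⊔ e ⊔ o ⊔ f)) where
  infixl 7 _∘_
  infixr 6 _⇒_
  infix  4 _≈_ _≤_ _⊑_
  field
    Carrier : Set c
    _≈_     : Rel Carrier e
    _≤_     : Rel Carrier o
    _∘_     : Op₂ Carrier
    _⇒_     : Op₂ Carrier
    k s     : Carrier
    Φ       : Pred Carrier f

  _⊑_ : Rel Carrier (c ⊔ o ⊔ f)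
  a ⊑ b = ∃[ g ] (g ∈ Φ × g ∘ a ≤ b)

  -- Polynomials in n variables (de Bruijn indices).
  infixl 7 _⊙_
  data Poly (n : ℕ) : Set c where
    var : Fin n → Poly n
    con : Carrier → Poly n
    _⊙_ : Poly n → Poly n → Poly n

  -- strengthen t = just t′ exactly when variable 0 does not occur in t.
  strengthen : ∀ {n} → Poly (suc n) → Maybe (Poly n)
  strengthen (var zero)    = nothing
  strengthen (var (suc i)) = just (var i)
  strengthen (con a)       = just (con a)
  strengthen (t ⊙ u)       = zipWith _⊙_ (strengthen t) (strengthen u)

  -- Bracket abstraction of variable 0: λ*y.t is k t when y does not occur
  -- in t, λ*y.y is s k k, and otherwise λ*y.(t u) is s (λ*y.t) (λ*y.u).
  λ* : ∀ {n} → Poly (suc n) → Poly n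
  λ* (var zero)    = con s ⊙ con k ⊙ con k
  λ* (var (suc i)) = con k ⊙ var i
  λ* (con a)       = con k ⊙ con a
  λ* (t ⊙ u)       =
    maybe′ (con k ⊙_) (con s ⊙ λ* t ⊙ λ* u) (strengthen (t ⊙ u))

  eval : Poly zero → Carrier
  eval (con a) = a
  eval (t ⊙ u) = eval t ∘ eval u

  -- λ*x.λ*y.λ*z. z x y
  p : Carrier
  p = eval (λ* (λ* (λ* (z ⊙ x ⊙ y))))
    where
    x y z : Poly 3
    x = var (suc (suc zero))
    y = var (suc zero)
    z = var zero

  infixl 7 _∧_
  _∧_ : Op₂ Carrier
  a ∧ b = p ∘ a ∘ b

------------------------------------------------------------------------
-- Abstract Krivine structures

record AKS ℓ : Set (lsuc ℓ) where
  infixr 6 _·_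
  infixl 7 _$_
  infix  4 _⊥_
  field
    Λ Π  : Set ℓ
    _⊥_  : Λ → Π → Set ℓ
    _·_  : Λ → Π → Π
    _$_  : Λ → Λ → Λ
    QP   : Pred Λ ℓ
    K S  : Λ
    QP-$ : ∀ {t u} → t ∈ QP → u ∈ QP → t $ u ∈ QP
    QP-K : K ∈ QP
    QP-S : S ∈ QP
    ⊥-$  : ∀ {t u π} → t ⊥ u · π → t $ u ⊥ π
    ⊥-K  : ∀ {t u π} → t ⊥ π → K ⊥ t · u · π
    ⊥-S  : ∀ {t u v π} → t $ v $ (u $ v) ⊥ π → S ⊥ t · u · v · π

module Krivine {ℓ} (𝒦 : AKS ℓ) where
  open AKS 𝒦

  infix 4 _⊥ᴾ_
  _⊥ᴾ_ : Λ → Pred Π ℓ → Set ℓ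
  t ⊥ᴾ P = ∀ {π} → π ∈ P → t ⊥ π

  infix 9 _^⊥ ⊥^_
  _^⊥ : Pred Λ ℓ → Pred Π ℓ
  (L ^⊥) π = ∀ {t} → t ∈ L → t ⊥ π

  ⊥^_ : Pred Π ℓ → Pred Λ ℓ
  (⊥^ P) t = t ⊥ᴾ P

  closure : Pred Π ℓ → Pred Π ℓ
  closure P = (⊥^ P) ^⊥

  hat : Pred Π ℓ → Pred Π ℓ
  hat P π = ∃[ ρ ] (ρ ∈ P × π ∈ closure ｛ ρ ｝)

  -- 𝒫•(Π); subsets are equal when they have the same elements.
  record 𝒫• : Set (lsuc ℓ) where
    constructor mk
    field
      set       : Pred Π ℓ
      hat-fixed : hat set ≐ set
  open 𝒫• public

  infix 4 _≈•_ _≤•_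
  _≈•_ _≤•_ : Rel 𝒫• ℓ
  P ≈• Q = set P ≐ set Q
  P ≤• Q = set P ⊇ set Q

  ∈-closure : ∀ {π} → π ∈ closure ｛ π ｝
  ∈-closure t⊥ = t⊥ refl

  closure-trans : ∀ {π ρ σ} → σ ∈ closure ｛ ρ ｝ → ρ ∈ closure ｛ π ｝ →
                  σ ∈ closure ｛ π ｝
  closure-trans σ∈ ρ∈ t⊥ = σ∈ λ { refl → ρ∈ t⊥ }

  hat-extensive : ∀ P → P ⊆ hat P
  hat-extensive P π∈ = _ , π∈ , ∈-closure

  hat• : Pred Π ℓ → 𝒫•
  hat• P = mk (hat P)
    ( (λ { (_ , (ρ , ρ∈P , ρ′∈) , π∈) → ρ , ρ∈P , closure-trans π∈ ρ′∈ })
    , hat-extensive (hat P) )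

  polar• : Pred Λ ℓ → 𝒫•
  polar• L = mk (L ^⊥)
    ( (λ { (_ , ρ∈ , π∈) t∈L → π∈ λ { refl → ρ∈ t∈L } })
    , hat-extensive (L ^⊥) )

  infixr 6 _→•_
  _→•_ : Op₂ 𝒫•
  P →• Q = hat• λ ρ → ∃₂ λ t π → t ∈ ⊥^ set P × π ∈ set Q × ρ ≡ t · π

  infixl 7 _∘•_
  _∘•_ : Op₂ 𝒫•
  P ∘• Q = mk R
    ( (λ { (_ , ρ∈R , π∈) t∈ π′∈ → ρ∈R t∈ (closure-trans π′∈ π∈) })
    , hat-extensive R )
    where
    R : Pred Π ℓ
    R π = ∀ {t π′} → t ∈ ⊥^ set Q → π′ ∈ closure ｛ π ｝ → t · π′ ∈ set P

  E B : Λ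
  E = S $ (K $ (S $ K $ K))
  B = S $ (K $ S) $ K

  k• s• : 𝒫•
  k• = polar• ｛ E $ K ｝
  s• = polar• ｛ E $ (B $ E $ S) ｝

  Φ• : Pred 𝒫• ℓ
  Φ• P = ∃[ t ] (t ∈ QP × t ⊥ᴾ set P)

  𝒜• : RawIOCA (lsuc ℓ) ℓ ℓ ℓ
  𝒜• = record
    { Carrier = 𝒫•
    ; _≈_     = _≈•_
    ; _≤_     = _≤•_
    ; _∘_     = _∘•_
    ; _⇒_     = _→•_
    ; k       = k•
    ; s       = s•
    ; Φ       = Φ•
    }

  open RawIOCA 𝒜• public using (p)
    renaming (_⊑_ to infix 4 _⊑𝒜_; _∧_ to infixl 7 _∧•_)

  infix 4 _⊑•_
  _⊑•_ : Rel 𝒫• ℓ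
  Q ⊑• R = ∃[ t ] (t ∈ QP × t ⊥ᴾ set (Q →• R))

{-# OPTIONS --safe #-}

-- 𝒜• is a full adjunction implicative ordered combinatory algebra:
-- F ∘• Q ≤• R iff F ≤• Q →• R. Since Φ• is upward closed, some F ∈ Φ•
-- satisfies F ∘• Q ≤• R iff Q →• R itself has a realizer in QP. The Heyting
-- structure comes from combinatory completeness, which holds only up to ≤•:
-- applying λ* t to a gives an element below t[a]. The combinator E is what
-- turns t $ u ⊥ π back into a statement E $ t ⊥ u · π about stacks.

module Submission where

open import Defs
open import Level using (_⊔_)
import Data.Empty.Polymorphic as Empty
open import Data.Fin.Base using (zero; suc)
open import Data.Maybe.Base using (just; nothing)
open import Data.Maybe.Relation.Unary.All using (All; just; nothing)
open import Data.Nat.Base using (suc)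
open import Data.Product.Base using (_×_; ∃-syntax; _,_; proj₁; proj₂)
open import Data.Vec.Base using (Vec; []; _∷_; lookup)
open import Function.Base using (id; _∘′_)
open import Function.Bundles using (_⇔_; mk⇔; Equivalence)
open import Function.Properties.Equivalence using () renaming (sym to ⇔-sym)
open import Relation.Binary.Core using (Rel)
open import Relation.Binary.Definitions using (Monotonic₂)
open import Relation.Binary.Morphism.Structures using (IsOrderIsomorphism)
open import Relation.Binary.PropositionalEquality.Core
  using (_≡_; refl; cong₂; subst; sym)
open import Relation.Binary.Structures using (IsPreorder)
open import Relation.Unary using (_∈_; ｛_｝)
open import Relation.Unary.Properties using (≐-refl; ≐-sym; ≐-trans)

-- Heyting structure under equivalent relations.

IsHeytingPreorder-resp-⇔ :
  ∀ {a e ℓ₁ ℓ₂} {A : Set a} {_≈_ : Rel A e} {_≤₁_ : Rel A ℓ₁} {_≤₂_ : Rel A ℓ₂}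
  {_∧_ ⊤ _⇨_} → (∀ x y → (x ≤₁ y) ⇔ (x ≤₂ y)) →
  IsHeytingPreorder _≈_ _≤₁_ _∧_ ⊤ _⇨_ → IsHeytingPreorder _≈_ _≤₂_ _∧_ ⊤ _⇨_
IsHeytingPreorder-resp-⇔ {_≤₁_ = _≤₁_} {_≤₂_} eq H = record
  { isPreorder  = record
    { isEquivalence = P.isEquivalence
    ; reflexive     = λ x≈y → to (P.reflexive x≈y)
    ; trans         = λ x≤y y≤z → to (P.trans (from x≤y) (from y≤z))
    }
  ; infimum     = λ x y →
      let l , r , glb = H.infimum x y
      in to l , to r , λ z z≤x z≤y → to (glb z (from z≤x) (from z≤y))
  ; maximum     = λ x → to (H.maximum x)
  ; exponential = λ w x y →
      let cur , uncur = H.exponential w x y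
      in to ∘′ cur ∘′ from , to ∘′ uncur ∘′ from
  }
  where
  module H = IsHeytingPreorder H
  module P = IsPreorder H.isPreorder
  to : ∀ {x y} → x ≤₁ y → x ≤₂ y
  to = Equivalence.to (eq _ _)
  from : ∀ {x y} → x ≤₂ y → x ≤₁ y
  from = Equivalence.from (eq _ _)

-- Combinatory algebras with filter: bracket abstraction and Heyting structure.

record IsFullAdjunctionIOCA {c e o f} (𝒜 : RawIOCA c e o f) :
  Set (c ⊔ e ⊔ o ⊔ f) where
  open RawIOCA 𝒜
  field
    ≤-isPreorder : IsPreorder _≈_ _≤_
    ∘-mono       : Monotonic₂ _≤_ _≤_ _≤_ _∘_
    k-≤          : ∀ a b → k ∘ a ∘ b ≤ a
    s-≤          : ∀ a b c → s ∘ a ∘ b ∘ c ≤ a ∘ c ∘ (b ∘ c)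
    adjunction   : ∀ a b c → (a ∘ b ≤ c) ⇔ (a ≤ b ⇒ c)
    Φ-∘          : ∀ {a b} → a ∈ Φ → b ∈ Φ → a ∘ b ∈ Φ
    Φ-k          : k ∈ Φ
    Φ-s          : s ∈ Φ

module IOCA {c e o f} {𝒜 : RawIOCA c e o f} (isIOCA : IsFullAdjunctionIOCA 𝒜)
  where
  open RawIOCA 𝒜
  open IsFullAdjunctionIOCA isIOCA
  open IsPreorder ≤-isPreorder using (isEquivalence)
    renaming (refl to ≤-refl; reflexive to ≤-reflexive; trans to ≤-trans)

  ⟦_⟧ : ∀ {n} → Poly n → Vec Carrier n → Carrier
  ⟦ var i ⟧ ρ = lookup ρ i
  ⟦ con a ⟧ ρ = a
  ⟦ t ⊙ u ⟧ ρ = ⟦ t ⟧ ρ ∘ ⟦ u ⟧ ρ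

  eval≡⟦⟧ : ∀ t → eval t ≡ ⟦ t ⟧ []
  eval≡⟦⟧ (con a) = refl
  eval≡⟦⟧ (t ⊙ u) = cong₂ _∘_ (eval≡⟦⟧ t) (eval≡⟦⟧ u)

  -- `All` over `Maybe` claims nothing when variable 0 occurs, which matches the case split made by
  -- `λ*` on applications.
  strengthen-⟦⟧ : ∀ {n} (t : Poly (suc n)) {a ρ} →
    All (λ t′ → ⟦ t ⟧ (a ∷ ρ) ≡ ⟦ t′ ⟧ ρ) (strengthen t)
  strengthen-⟦⟧ (var zero)    = nothing
  strengthen-⟦⟧ (var (suc i)) = just refl
  strengthen-⟦⟧ (con a)       = just refl
  strengthen-⟦⟧ (t ⊙ u) {a} {ρ}
    with strengthen t | strengthen-⟦⟧ t {a} {ρ}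
       | strengthen u | strengthen-⟦⟧ u {a} {ρ}
  ... | nothing | _       | _       | _       = nothing
  ... | just _  | just _  | nothing | _       = nothing
  ... | just _  | just eq | just _  | just er = just (cong₂ _∘_ eq er)

  i-≤ : ∀ a → s ∘ k ∘ k ∘ a ≤ a
  i-≤ a = ≤-trans (s-≤ k k a) (k-≤ a (k ∘ a))

  -- Induction on the polynomial: constant clauses use `k-≤`, the `s` clause uses `s-≤` and then
  -- joins the induction hypotheses by monotonicity of `∘`.
  λ*-β : ∀ {n} (t : Poly (suc n)) a ρ → ⟦ λ* t ⟧ ρ ∘ a ≤ ⟦ t ⟧ (a ∷ ρ)
  λ*-β (var zero)    a ρ = i-≤ a
  λ*-β (var (suc i)) a ρ = k-≤ (lookup ρ i) a
  λ*-β (con b)       a ρ = k-≤ b a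
  λ*-β (t ⊙ u)       a ρ
    with strengthen (t ⊙ u) | strengthen-⟦⟧ (t ⊙ u) {a} {ρ}
  ... | just v  | just eq = subst (k ∘ ⟦ v ⟧ ρ ∘ a ≤_) (sym eq) (k-≤ (⟦ v ⟧ ρ) a)
  ... | nothing | nothing =
    ≤-trans (s-≤ (⟦ λ* t ⟧ ρ) (⟦ λ* u ⟧ ρ) a) (∘-mono (λ*-β t a ρ) (λ*-β u a ρ))

  -- The invariant that keeps witnesses in the filter: bracket abstraction adds only the constants
  -- `k` and `s`, and closed members evaluate inside `Φ`.
  data ΦPoly {n} : Poly n → Set (c ⊔ f) where
    var : ∀ i → ΦPoly (var i)
    con : ∀ {a} → a ∈ Φ → ΦPoly (con a)
    _⊙_ : ∀ {t u} → ΦPoly t → ΦPoly u → ΦPoly (t ⊙ u)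

  strengthen-Φ : ∀ {n} {t : Poly (suc n)} → ΦPoly t → All ΦPoly (strengthen t)
  strengthen-Φ (var zero)    = nothing
  strengthen-Φ (var (suc i)) = just (var i)
  strengthen-Φ (con a∈Φ)     = just (con a∈Φ)
  strengthen-Φ (_⊙_ {t} {u} t∈ u∈)
    with strengthen t | strengthen-Φ t∈ | strengthen u | strengthen-Φ u∈
  ... | nothing | _       | _       | _       = nothing
  ... | just _  | just _  | nothing | _       = nothing
  ... | just _  | just t∈ | just _  | just u∈ = just (t∈ ⊙ u∈)

  λ*-Φ : ∀ {n} {t : Poly (suc n)} → ΦPoly t → ΦPoly (λ* t)
  λ*-Φ (var zero)    = con Φ-s ⊙ con Φ-k ⊙ con Φ-k
  λ*-Φ (var (suc i)) = con Φ-k ⊙ var i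
  λ*-Φ (con a∈Φ)     = con Φ-k ⊙ con a∈Φ
  λ*-Φ (_⊙_ {t} {u} t∈ u∈)
    with strengthen (t ⊙ u) | strengthen-Φ (t∈ ⊙ u∈)
  ... | just _  | just v∈ = con Φ-k ⊙ v∈
  ... | nothing | nothing = con Φ-s ⊙ λ*-Φ t∈ ⊙ λ*-Φ u∈

  ⟦⟧-Φ : ∀ {t} → ΦPoly t → ⟦ t ⟧ [] ∈ Φ
  ⟦⟧-Φ (con a∈Φ) = a∈Φ
  ⟦⟧-Φ (t∈ ⊙ u∈) = Φ-∘ (⟦⟧-Φ t∈) (⟦⟧-Φ u∈)

  ⊑-λ* : ∀ {t a b} → ΦPoly t → ⟦ t ⟧ (a ∷ []) ≤ b → a ⊑ b
  ⊑-λ* {t} {a} t∈ t≤b = _ , ⟦⟧-Φ (λ*-Φ t∈) , ≤-trans (λ*-β t a []) t≤b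

  private
    pair : Poly 3
    pair = var zero ⊙ var (suc (suc zero)) ⊙ var (suc zero)

  p-≤ : ∀ a b c → p ∘ a ∘ b ∘ c ≤ c ∘ a ∘ b
  p-≤ a b c =
    subst (λ q → q ∘ a ∘ b ∘ c ≤ c ∘ a ∘ b) (sym (eval≡⟦⟧ (λ* (λ* (λ* pair)))))
      (≤-trans (∘-mono (∘-mono (λ*-β (λ* (λ* pair)) a []) ≤-refl) ≤-refl)
      (≤-trans (∘-mono (λ*-β (λ* pair) b (a ∷ [])) ≤-refl)
      (λ*-β pair c (b ∷ a ∷ []))))

  Φ-p : p ∈ Φ
  Φ-p = subst (_∈ Φ) (sym (eval≡⟦⟧ (λ* (λ* (λ* pair)))))
    (⟦⟧-Φ (λ*-Φ (λ*-Φ (λ*-Φ (var zero ⊙ var (suc (suc zero)) ⊙ var (suc zero))))))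

  -- Sends x and then y to y, so a pair applied to it yields its second component, as `k` yields the
  -- first.
  k′ : Carrier
  k′ = k ∘ (s ∘ k ∘ k)

  Φ-k′ : k′ ∈ Φ
  Φ-k′ = Φ-∘ Φ-k (Φ-∘ (Φ-∘ Φ-s Φ-k) Φ-k)

  ∧-fst : ∀ a b → (a ∧ b) ∘ k ≤ a
  ∧-fst a b = ≤-trans (p-≤ a b k) (k-≤ a b)

  ∧-snd : ∀ a b → (a ∧ b) ∘ k′ ≤ b
  ∧-snd a b =
    ≤-trans (p-≤ a b k′) (≤-trans (∘-mono (k-≤ _ a) ≤-refl) (i-≤ b))

  ⊑-isPreorder : IsPreorder _≈_ _⊑_
  ⊑-isPreorder = record
    { isEquivalence = isEquivalence
    ; reflexive     = λ a≈b → ⊑-λ* (var zero) (≤-reflexive a≈b)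
    ; trans         = λ (_ , g∈Φ , ga≤b) (_ , h∈Φ , hb≤c) →
        ⊑-λ* (con h∈Φ ⊙ (con g∈Φ ⊙ var zero))
          (≤-trans (∘-mono ≤-refl ga≤b) hb≤c)
    }

  ∧-lower₁ : ∀ a b → a ∧ b ⊑ a
  ∧-lower₁ a b = ⊑-λ* (var zero ⊙ con Φ-k) (∧-fst a b)

  ∧-lower₂ : ∀ a b → a ∧ b ⊑ b
  ∧-lower₂ a b = ⊑-λ* (var zero ⊙ con Φ-k′) (∧-snd a b)

  ∧-greatest : ∀ {a b c} → c ⊑ a → c ⊑ b → c ⊑ a ∧ b
  ∧-greatest (_ , g∈Φ , gc≤a) (_ , h∈Φ , hc≤b) =
    ⊑-λ* (con Φ-p ⊙ (con g∈Φ ⊙ var zero) ⊙ (con h∈Φ ⊙ var zero))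
      (∘-mono (∘-mono ≤-refl gc≤a) hc≤b)

  -- Abstract `b` first, with `a` as a parameter: the polynomial λ*y. g (p a y) applied to `b` lies
  -- below `c`, the adjunction moves `b` across, and `⊑-λ*` abstracts `a`.
  ⇒-curry : ∀ {a b c} → a ∧ b ⊑ c → a ⊑ b ⇒ c
  ⇒-curry {a} {b} {c} (g , g∈Φ , g≤c) =
    ⊑-λ* (λ*-Φ (con g∈Φ ⊙ (con Φ-p ⊙ var (suc zero) ⊙ var zero)))
      (Equivalence.to (adjunction _ b c)
        (≤-trans (λ*-β (con g ⊙ (con p ⊙ var (suc zero) ⊙ var zero)) b (a ∷ []))
          g≤c))

  ⇒-uncurry : ∀ {a b c} → a ⊑ b ⇒ c → a ∧ b ⊑ c
  ⇒-uncurry {a} {b} {c} (g , g∈Φ , ga≤b⇒c) =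
    ⊑-λ* (con g∈Φ ⊙ (var zero ⊙ con Φ-k) ⊙ (var zero ⊙ con Φ-k′))
      (≤-trans (∘-mono (∘-mono ≤-refl (∧-fst a b)) (∧-snd a b))
        (Equivalence.from (adjunction _ b c) ga≤b⇒c))

  ⊑-isHeytingPreorder : ∀ {⊤} → (∀ a → a ≤ ⊤) →
                        IsHeytingPreorder _≈_ _⊑_ _∧_ ⊤ _⇒_
  ⊑-isHeytingPreorder ≤⊤ = record
    { isPreorder  = ⊑-isPreorder
    ; infimum     = λ a b → ∧-lower₁ a b , ∧-lower₂ a b , λ _ → ∧-greatest
    -- Any element of `Φ` would do, since every value lies below the top; `k` is one at hand.
    ; maximum     = λ _ → _ , Φ-k , ≤⊤ _
    ; exponential = λ _ _ _ → ⇒-curry , ⇒-uncurry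
    }

-- The algebra of an abstract Krivine structure.

module _ {ℓ} (𝒦 : AKS ℓ) where
  open AKS 𝒦
  open Krivine 𝒦

  ⊥-I : ∀ {t π} → t ⊥ π → S $ K $ K ⊥ t · π
  ⊥-I t⊥π = ⊥-$ (⊥-$ (⊥-S (⊥-$ (⊥-$ (⊥-K t⊥π)))))

  -- With I = S K K, the term `E` is S (K I), and S (K I) t u reduces to K I u (t u), then I (t u),
  -- then t u.
  ⊥-E : ∀ {t u π} → t $ u ⊥ π → E ⊥ t · u · π
  ⊥-E tu⊥π = ⊥-$ (⊥-S (⊥-$ (⊥-$ (⊥-$ (⊥-K (⊥-I tu⊥π))))))

  -- The head `t` is left facing the stack instead of being applied, because this is the form in
  -- which `⊥-E` delivers its conclusion.
  ⊥-B : ∀ {t u v π} → t ⊥ (u $ v) · π → B ⊥ t · u · v · π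
  ⊥-B t⊥uv·π =
    ⊥-$ (⊥-$ (⊥-S (⊥-$ (⊥-$ (⊥-$ (⊥-K (⊥-S (⊥-$ (⊥-$ (⊥-$ (⊥-K t⊥uv·π)))))))))))

  QP-E : E ∈ QP
  QP-E = QP-$ QP-S (QP-$ QP-K (QP-$ (QP-$ QP-S QP-K) QP-K))

  QP-B : B ∈ QP
  QP-B = QP-$ (QP-$ QP-S (QP-$ QP-K QP-S)) QP-K

  -- A term orthogonal to ρ is orthogonal to the whole closure of ρ by definition of the double
  -- polar, so saturation loses no realizers.
  ⊥ᴾ-hat : ∀ {t P} → t ⊥ᴾ P → t ⊥ᴾ hat P
  ⊥ᴾ-hat t⊥P (_ , ρ∈P , π∈) = π∈ λ { refl → t⊥P ρ∈P }

  ⊥ᴾ-→• : ∀ {t P Q} → (∀ {u π} → u ⊥ᴾ set P → π ∈ set Q → t ⊥ u · π) →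
          t ⊥ᴾ set (P →• Q)
  ⊥ᴾ-→• t⊥ = ⊥ᴾ-hat λ { (_ , _ , u⊥P , π∈Q , refl) → t⊥ u⊥P π∈Q }

  ⊥ᴾ-∘• : ∀ {t u P Q} → t ⊥ᴾ set P → u ⊥ᴾ set Q → t $ u ⊥ᴾ set (P ∘• Q)
  ⊥ᴾ-∘• t⊥P u⊥Q π∈ = ⊥-$ (t⊥P (π∈ u⊥Q ∈-closure))

  ∈-closed : ∀ P {π ρ} → π ∈ set P → ρ ∈ closure ｛ π ｝ → ρ ∈ set P
  ∈-closed P {π} π∈P ρ∈ = proj₁ (hat-fixed P) (π , π∈P , λ {t} → ρ∈ {t})

  -- Both halves rest on saturation: `P` absorbs the closure of pushes taken in `→•`, and `R`
  -- absorbs the closure of π over which `∘•` quantifies.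
  ∘•-adjunction : ∀ P Q R → (P ∘• Q ≤• R) ⇔ (P ≤• Q →• R)
  ∘•-adjunction P Q R = mk⇔ curry uncurry
    where
    curry : P ∘• Q ≤• R → P ≤• Q →• R
    curry R⊆ (_ , (_ , _ , t⊥Q , π∈R , refl) , σ∈) =
      ∈-closed P (R⊆ π∈R t⊥Q ∈-closure) σ∈

    uncurry : P ≤• Q →• R → P ∘• Q ≤• R
    uncurry ⊆P π∈R {t} t⊥Q π′∈ =
      ⊆P (hat-extensive _ (t , _ , (λ {σ} → t⊥Q {σ}) , ∈-closed R π∈R π′∈ , refl))

  ∘•-mono : Monotonic₂ _≤•_ _≤•_ _≤•_ _∘•_
  ∘•-mono P⊇P′ Q⊇Q′ π∈ t⊥Q π′∈ = P⊇P′ (π∈ (λ ρ∈ → t⊥Q (Q⊇Q′ ρ∈)) π′∈)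

  -- The polar of `t` is the `≤•`-least element realized by `t`; this turns the laws of `k•` and
  -- `s•` into realizability claims.
  polar•-≤ : ∀ {t} P → t ⊥ᴾ set P → polar• ｛ t ｝ ≤• P
  polar•-≤ P t⊥P π∈ refl = t⊥P π∈

  polar•-Φ : ∀ {t} → t ∈ QP → Φ• (polar• ｛ t ｝)
  polar•-Φ t∈QP = _ , t∈QP , λ π∈ → π∈ refl

  -- The stack below `u` lies in a hat of pushes and need not be a push, so `⊥-K` does not apply
  -- directly. `E` first forms `K $ u`, which by `⊥ᴾ-→•` need only be tested on pushes.
  k•-≤ : ∀ P Q → k• ∘• P ∘• Q ≤• P
  k•-≤ P Q = Equivalence.from (∘•-adjunction (k• ∘• P) Q P)
    (Equivalence.from (∘•-adjunction k• P (Q →• P))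
      (polar•-≤ (P →• Q →• P)
        (⊥ᴾ-→• {P = P} {Q →• P} λ u⊥P ρ∈ →
          ⊥-$ (⊥-E (⊥ᴾ-→• {P = Q} {P} (λ _ π∈P → ⊥-$ (⊥-K (u⊥P π∈P))) ρ∈)))))

  -- Each of the two inner arrows costs one `E`. `B` composes the second with `S`, since B E S u
  -- reduces to E (S u), which then meets `v`.
  s•-≤ : ∀ P Q R → s• ∘• P ∘• Q ∘• R ≤• P ∘• R ∘• (Q ∘• R)
  s•-≤ P Q R = Equivalence.from (∘•-adjunction (s• ∘• P ∘• Q) R T)
    (Equivalence.from (∘•-adjunction (s• ∘• P) Q (R →• T))
      (Equivalence.from (∘•-adjunction s• P (Q →• R →• T))
        (polar•-≤ (P →• Q →• R →• T)
          (⊥ᴾ-→• {P = P} {Q →• R →• T} λ u⊥P σ∈ →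
            ⊥-$ (⊥-E (⊥ᴾ-→• {P = Q} {R →• T} (λ v⊥Q ρ∈ →
              ⊥-$ (⊥-$ (⊥-$ (⊥-B (⊥-E (⊥ᴾ-→• {P = R} {T} (λ w⊥R π∈T →
                ⊥-$ (⊥-$ (⊥-S (⊥ᴾ-∘• {P = P ∘• R} {Q ∘• R}
                  (⊥ᴾ-∘• {P = P} {R} u⊥P w⊥R)
                  (⊥ᴾ-∘• {P = Q} {R} v⊥Q w⊥R) π∈T)))) ρ∈)))))) σ∈))))))
    where T = P ∘• R ∘• (Q ∘• R)

  𝒜•-isIOCA : IsFullAdjunctionIOCA 𝒜•
  𝒜•-isIOCA = record
    { ≤-isPreorder = record
      { isEquivalence = record { refl = ≐-refl ; sym = ≐-sym ; trans = ≐-trans }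
      ; reflexive     = proj₂
      ; trans         = λ P⊇Q Q⊇R π∈ → P⊇Q (Q⊇R π∈)
      }
    ; ∘-mono     = λ {P} {P′} {Q} {Q′} → ∘•-mono {P} {P′} {Q} {Q′}
    ; k-≤        = k•-≤
    ; s-≤        = s•-≤
    ; adjunction = ∘•-adjunction
    ; Φ-∘        = λ {P} {Q} (_ , t∈QP , t⊥P) (_ , u∈QP , u⊥Q) →
        _ , QP-$ t∈QP u∈QP , ⊥ᴾ-∘• {P = P} {Q} t⊥P u⊥Q
    ; Φ-k        = polar•-Φ (QP-$ QP-E QP-K)
    ; Φ-s        = polar•-Φ (QP-$ QP-E (QP-$ (QP-$ QP-B QP-E) QP-S))
    }

  ⊑•⇔⊑𝒜 : ∀ Q R → (Q ⊑• R) ⇔ (Q ⊑𝒜 R)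
  ⊑•⇔⊑𝒜 Q R = mk⇔
    -- `Q ⊑• R` unfolds to membership of `Q →• R` in `Φ•`; the inequality is the counit of the
    -- adjunction.
    (λ Q→R∈Φ → Q →• R , Q→R∈Φ ,
      λ {π} → Equivalence.from (∘•-adjunction (Q →• R) Q R) id {π})
    -- By adjunction `F` contains `Q →• R`, so the realizer of `F` serves unchanged.
    (λ (F , (t , t∈QP , t⊥F) , FQ≤R) →
      t , t∈QP , λ π∈ → t⊥F (Equivalence.to (∘•-adjunction F Q R) FQ≤R π∈))

  -- The greatest element, because `≤•` is reverse inclusion.
  ∅• : 𝒫•
  ∅• = mk (λ _ → Empty.⊥) ((λ ()) , λ ())

mainTheorem10 : ∀ {ℓ} (𝒦 : AKS ℓ) →
    let open Krivine 𝒦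
    in (∀ Q R → (Q ⊑• R) ⇔ (Q ⊑𝒜 R))
    × IsOrderIsomorphism _≈•_ _≈•_ _⊑•_ _⊑𝒜_ id
    × ∃[ ⊤ ] IsHeytingPreorder _≈•_ _⊑•_ _∧•_ ⊤ _→•_
mainTheorem10 𝒦 =
    ⊑•⇔⊑𝒜 𝒦
  , record
    { isOrderMonomorphism = record
      { isOrderHomomorphism = record
        { cong = id
        ; mono = λ {Q R} → Equivalence.to (⊑•⇔⊑𝒜 𝒦 Q R)
        }
      ; injective = id
      ; cancel    = λ {Q R} → Equivalence.from (⊑•⇔⊑𝒜 𝒦 Q R)
      }
    ; surjective = λ P → P , id
    }
  , ∅• 𝒦
  , IsHeytingPreorder-resp-⇔ (λ Q R → ⇔-sym (⊑•⇔⊑𝒜 𝒦 Q R))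
      (IOCA.⊑-isHeytingPreorder (𝒜•-isIOCA 𝒦) λ _ ())
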